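{- There is an absolute constant $C>0$ such that the following holds. Let $k\ge \ell\ge 1$ be integers, and let $\lambda=(\lambda_1\ge\cdots\ge\lambda_\ell\ge 0)$ be an integer partition with $\lambda_1\ge 2$. Let $\lambda'=(\lambda'_1\ge\lambda'_2\ge\cdots\ge\lambda'_{\lambda_1})$ be the partition conjugate to $\lambda$, and set $d=\max_{1\le j\le\lambda_1}\lambda'_j(k-\lambda'_j)$. Then the semiring complexity of the Schur polynomial $s_\lambda(x_1,\dots,x_k)$ is at most $$C\,\log(\lambda_1)\,k^5\,2^{k\ell}\,\ell^{d}.$$
   Context: Semiring complexity: for a polynomial $f(x_1,\dots,x_k)$ with nonnegative integer coefficients, the semiring complexity of $f$ is the smallest number of gates in an arithmetic circuit in which each gate performs a (binary) addition or multiplication, whose inputs are $x_1,\dots,x_k$ together with any positive integer scalars, and whose output is $f(x_1,\dots,x_k)$. Subtraction and division are not allowed; gates may have arbitrary fan-out. Schur polynomial: a semistandard Young tableau $T$ of shape $\lambda$ is an array of positive integers $T=(t_{i,j}\mid 1\le i\le\ell,\ 1\le j\le\lambda_i)$ with $t_{i,j}<t_{i+1,j}$ and $t_{i,j}\le t_{i,j+1}$ whenever both entries exist. Then $s_\lambda(x_1,\dots,x_k)=\sum_T\prod_{i,j}x_{t_{i,j}}$, the sum over all semistandard Young tableaux $T$ of shape $\lambda$ with entries in $\{1,\dots,k\}$. The conjugate partition $\lambda'$ has as parts $\lambda'_j=\#\{i:\lambda_i\ge j\}$. -}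

module Defs where

open import Data.Fin using (Fin; toℕ)
import Data.Fin as Fin
import Data.Fin.Properties as Fin
open import Data.List using (List; []; _∷_; [_]; _++_; map; foldr; filter; cartesianProductWith; allFin; upTo)
import Data.List as List
import Data.List.Extrema.Nat as Extrema
open import Data.List.Relation.Binary.Permutation.Propositional using (_↭_)
open import Data.Nat using (ℕ; zero; suc; _+_; _*_; _∸_; _≤_; _≥_; _≤?_; NonZero)
import Data.Nat.Properties as ℕ
open import Data.Product using (Σ; ∃; _×_; _,_)
open import Data.Vec using (Vec; []; _∷_; lookup; toList; zipWith; count; _[_]≔_)
import Data.Vec as Vec
open import Data.Vec.Relation.Unary.All using (All; []; _∷_)
open import Data.Vec.Relation.Unary.All.Properties using (lookup⁺)
open import Data.Vec.Relation.Unary.Linked using (Linked)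
open import Function.Bundles using (_⇔_; mk⇔)
open import Relation.Binary.PropositionalEquality using (_≡_)
open import Relation.Nullary.Decidable using (Dec; _×-dec_; _→-dec_)

private
  variable
    k ℓ n : ℕ

-- A monomial in x₁,…,x_k is its exponent vector.  A polynomial with
-- coefficients in ℕ is a finite multiset of monomials, the coefficient of a
-- monomial being its multiplicity: a list considered up to permutation.

Monomial : ℕ → Set
Monomial k = Vec ℕ k

Poly : ℕ → Set
Poly k = List (Monomial k)

infix  4 _≈_
infixl 6 _⊕_
infixl 7 _⊗_

_≈_ : Poly k → Poly k → Set
_≈_ = _↭_

1ᴹ : Monomial k
1ᴹ = Vec.replicate _ 0

scalar : ℕ → Poly k
scalar c = List.replicate c 1ᴹ

var : Fin k → Poly k
var i = [ 1ᴹ [ i ]≔ 1 ]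

_⊕_ : Poly k → Poly k → Poly k
_⊕_ = _++_

_⊗_ : Poly k → Poly k → Poly k
_⊗_ = cartesianProductWith (zipWith _+_)

∑ : List (Poly k) → Poly k
∑ = foldr _⊕_ (scalar 0)

∏ : List (Poly k) → Poly k
∏ = foldr _⊗_ (scalar 1)

-- A circuit is a straight-line program: `Circuit k n` has n gates, and each
-- gate reads inputs or any earlier gates, so that fan-out is unrestricted.
-- Inputs are free.  `gate zero` is the most recently added gate.

data Source (k n : ℕ) : Set where
  input  : Fin k → Source k n
  const  : (c : ℕ) .{{_ : NonZero c}} → Source k n
  gate   : Fin n → Source k n

data Gate (k n : ℕ) : Set where
  add mul : Source k n → Source k n → Gate k n

infixl 5 _▷_

data Circuit (k : ℕ) : ℕ → Set where
  ∅   : Circuit k 0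
  _▷_ : Circuit k n → Gate k n → Circuit k (suc n)

evalSource : Vec (Poly k) n → Source k n → Poly k
evalSource vs (input i) = var i
evalSource vs (const c) = scalar c
evalSource vs (gate g)  = lookup vs g

evalGate : Vec (Poly k) n → Gate k n → Poly k
evalGate vs (add a b) = evalSource vs a ⊕ evalSource vs b
evalGate vs (mul a b) = evalSource vs a ⊗ evalSource vs b

gateValues : Circuit k n → Vec (Poly k) n
gateValues ∅       = []
gateValues (c ▷ g) = evalGate (gateValues c) g ∷ gateValues c

ComputableWith : Poly k → ℕ → Set
ComputableWith {k} f n =
  Σ (Circuit k n) λ c → Σ (Source k n) λ out → evalSource (gateValues c) out ≈ f

IsSemiringComplexity : Poly k → ℕ → Set
IsSemiringComplexity f n = ComputableWith f n × (∀ m → ComputableWith f m → n ≤ m)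

-- "The semiring complexity of f is at most b", phrased so that no minimal
-- circuit has to be exhibited; `complexity≤⇔` relates it to the minimum.

SemiringComplexity≤ : Poly k → ℕ → Set
SemiringComplexity≤ f b = ∃ λ n → n ≤ b × ComputableWith f n

complexity≤⇔ : {f : Poly k} {b : ℕ} → IsSemiringComplexity f n →
               SemiringComplexity≤ f b ⇔ n ≤ b
complexity≤⇔ (comp , least) = mk⇔
  (λ (m , m≤b , comp′) → ℕ.≤-trans (least m comp′) m≤b)
  (λ n≤b → _ , n≤b , comp)

-- Partitions with ℓ parts, zero parts allowed.

IsPartition : Vec ℕ ℓ → Set
IsPartition = Linked _≥_

-- Only meaningful for ℓ ≥ 1.
firstPart : Vec ℕ ℓ → ℕ
firstPart []      = 0
firstPart (p ∷ _) = p

conjugatePart : Vec ℕ ℓ → ℕ → ℕ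
conjugatePart μ j = count (j ≤?_) μ

-- max { μ′ⱼ (k - μ′ⱼ) : 1 ≤ j ≤ μ₁ }.  The default 0 matters only for μ₁ = 0,
-- and ∸ does not truncate when ℓ ≤ k, since μ′ⱼ ≤ ℓ.
maxProduct : ℕ → Vec ℕ ℓ → ℕ
maxProduct k μ = Extrema.max 0
  (map (λ j → conjugatePart μ j * (k ∸ conjugatePart μ j))
       (map suc (upTo (firstPart μ))))

-- A filling of shape μ: row i is a vector of length μᵢ.  The entries
-- 1,…,k are represented by Fin k.

Filling : ℕ → Vec ℕ ℓ → Set
Filling k μ = All (Vec (Fin k)) μ

entry : {μ : Vec ℕ ℓ} → Filling k μ → (i : Fin ℓ) → Fin (lookup μ i) → Fin k
entry T i j = lookup (lookup⁺ T i) j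

entries : {μ : Vec ℕ ℓ} → Filling k μ → List (Fin k)
entries []      = []
entries (r ∷ T) = toList r ++ entries T

RowsWeak : {μ : Vec ℕ ℓ} → Filling k μ → Set
RowsWeak {μ = μ} T =
  ∀ i (j j′ : Fin (lookup μ i)) → toℕ j′ ≡ suc (toℕ j) →
  entry T i j Fin.≤ entry T i j′

ColumnsStrict : {μ : Vec ℕ ℓ} → Filling k μ → Set
ColumnsStrict {μ = μ} T =
  ∀ i i′ → toℕ i′ ≡ suc (toℕ i) →
  ∀ (j : Fin (lookup μ i)) (j′ : Fin (lookup μ i′)) → toℕ j′ ≡ toℕ j →
  entry T i j Fin.< entry T i′ j′

IsSemistandard : {μ : Vec ℕ ℓ} → Filling k μ → Set
IsSemistandard T = RowsWeak T × ColumnsStrict T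

isSemistandard? : {μ : Vec ℕ ℓ} (T : Filling k μ) → Dec (IsSemistandard T)
isSemistandard? T =
  (Fin.all? λ i → Fin.all? λ j → Fin.all? λ j′ →
    (toℕ j′ ℕ.≟ suc (toℕ j)) →-dec (entry T i j Fin.≤? entry T i j′))
  ×-dec
  (Fin.all? λ i → Fin.all? λ i′ → (toℕ i′ ℕ.≟ suc (toℕ i)) →-dec
    (Fin.all? λ j → Fin.all? λ j′ →
      (toℕ j′ ℕ.≟ toℕ j) →-dec (entry T i j Fin.<? entry T i′ j′)))

allRows : ∀ k m → List (Vec (Fin k) m)
allRows k zero    = [ [] ]
allRows k (suc m) = cartesianProductWith _∷_ (allFin k) (allRows k m)

allFillings : ∀ k (μ : Vec ℕ ℓ) → List (Filling k μ)
allFillings k []      = [ [] ]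
allFillings k (m ∷ μ) = cartesianProductWith _∷_ (allRows k m) (allFillings k μ)

semistandardTableaux : ∀ k (μ : Vec ℕ ℓ) → List (Filling k μ)
semistandardTableaux k μ = filter isSemistandard? (allFillings k μ)

schur : ∀ k → Vec ℕ ℓ → Poly k
schur k μ = ∑ (map (λ T → ∏ (map var (entries T))) (semistandardTableaux k μ))

{-# OPTIONS --safe #-}
module Submission where

-- Reading a tableau column by column turns s_λ into an entry of a product of
-- transfer matrices, whose rows and columns are indexed by the k^ℓ possible
-- columns and whose (p, c) entry is the monomial of c if c may follow p.  The
-- matrix depends only on the height of the column, so the product consists of
-- at most ℓ blocks of equal factors, one for every distinct nonzero part of λ.
-- Each block is a power computed by repeated squaring, using O(k^(3ℓ) log λ₁)
-- gates, and k^(3ℓ) = O(2^(kℓ)) uniformly in ℓ ≤ k.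

open import Algebra.Bundles using (CommutativeMonoid)
import Algebra.Properties.CommutativeSemigroup as CommutativeSemigroupProperties
open import Defs
open import Data.Bool using (Bool; true; false; if_then_else_)
import Data.Bool.Properties as Bool
open import Data.Fin using (Fin; zero; suc; toℕ)
import Data.Fin as Fin
import Data.Fin.Properties as Fin
open import Data.List using (List; []; _∷_; [_]; _++_; map; filter; length; cartesianProductWith; cartesianProduct; allFin)
open import Data.List.Membership.Propositional using (_∈_)
open import Data.List.Membership.Propositional.Properties using (∈-cartesianProductWith⁺; ∈-cartesianProduct⁺; ∈-allFin; ∈-filter⁺)
import Data.List.Properties as List
open import Data.List.Relation.Binary.Permutation.Propositional using (_↭_; prep; swap; ↭-refl; ↭-sym; ↭-trans; ↭-reflexive; module PermutationReasoning)
open import Data.List.Relation.Binary.Permutation.Propositional.Properties using (++⁺; ++⁺ˡ; map⁺; shifts; ↭-empty-inv; ++-comm; ++-commutativeMonoid)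
open import Data.List.Relation.Unary.Any using (here; there)
open import Data.Nat using (ℕ; zero; suc; pred; _+_; _*_; _∸_; _^_; _≤_; _<_; _≥_; _>_; z≤n; s≤s; _≤?_; NonZero; >-nonZero; >-nonZero⁻¹)
open import Data.Nat.Logarithm using (⌊log₂_⌋; ⌊log₂⌋-mono-≤; ⌊log₂[2^n]⌋≡n)
import Data.Nat.Properties as ℕ
open import Data.Nat.Solver using (module +-*-Solver)
open import Data.Product using (∃; _×_; _,_; proj₁; proj₂; uncurry)
open import Data.Sum using (_⊎_; inj₁; inj₂)
open import Data.Vec using (Vec; []; _∷_; lookup; toList; zipWith)
import Data.Vec as Vec
import Data.Vec.Properties as Vec
open import Data.Vec.Relation.Unary.All using (All; []; _∷_)
import Data.Vec.Relation.Unary.All as All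
open import Data.Vec.Relation.Unary.All.Properties using (lookup⁺) renaming (map⁺ to All-map⁺)
open import Data.Vec.Relation.Unary.Any using (Any; here; there)
open import Data.Vec.Relation.Unary.Linked.Properties using (Linked⇒All)
open import Function using (_∘_; id; flip; it)
open import Function.Bundles using (_⇔_; mk⇔; Equivalence)
open import Relation.Binary.PropositionalEquality using (_≡_; refl; sym; trans; cong; cong₂; subst; module ≡-Reasoning)
open import Relation.Nullary using (¬_; Dec; yes; no; contradiction)
open import Relation.Nullary.Decidable using (does; does-⇔; _×-dec_; _→-dec_)

-- The matrix product comes from a stronger invariant. For a column p, `schurAfter p μ` sums over
-- the tableaux of shape μ that may stand directly to the right of p. Only adjacent columns
-- interact, so removing the first column c leaves the same quantity for c and the shortened shape.
-- All p are treated at once: a single vector of polynomials passes from block to block, starting at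
-- the right end of the tableau. The obstacle on the circuit side is zero: transfer entries may
-- vanish, yet scalars are positive. Zero is therefore tracked outside the circuit, and the output
-- has to be shown nonzero at the end, by an explicit tableau that exists because ℓ ≤ k. Beside
-- k^(3ℓ) log λ₁ the count has a factor ℓ for the blocks and a factor of at most ℓ for the monomials
-- in the matrices; k^5 absorbs both.

private
  variable
    k ℓ m n : ℕ
    A B : Set

-- The semiring of polynomials

≈-reflexive : {p q : Poly k} → p ≡ q → p ≈ q
≈-reflexive = ↭-reflexive

⊕-cong : {p p′ q q′ : Poly k} → p ≈ p′ → q ≈ q′ → p ⊕ q ≈ p′ ⊕ q′
⊕-cong = ++⁺

⊕-interchange : (p q r s : Poly k) → (p ⊕ q) ⊕ (r ⊕ s) ≈ (p ⊕ r) ⊕ (q ⊕ s)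
⊕-interchange {k} = CommSemigroup.interchange
  where
  module CommSemigroup = CommutativeSemigroupProperties
    (CommutativeMonoid.commutativeSemigroup (++-commutativeMonoid {A = Monomial k}))

⊗-distribʳ : (r p q : Poly k) → (p ⊕ q) ⊗ r ≡ (p ⊗ r) ⊕ (q ⊗ r)
⊗-distribʳ r []      q = refl
⊗-distribʳ r (x ∷ p) q = trans
  (cong (map (zipWith _+_ x) r ++_) (⊗-distribʳ r p q))
  (sym (List.++-assoc (map (zipWith _+_ x) r) (p ⊗ r) (q ⊗ r)))

-- The list product runs through its left factor on the outside, so distributing over a right-hand
-- sum reorders monomials, whereas `⊗-distribʳ` and `⊗-assoc` are equalities of lists.
⊗-distribˡ : (p q r : Poly k) → p ⊗ (q ⊕ r) ≈ (p ⊗ q) ⊕ (p ⊗ r)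
⊗-distribˡ []      q r = ↭-refl
⊗-distribˡ (x ∷ p) q r = ↭-trans
  (⊕-cong (≈-reflexive (List.map-++ (zipWith _+_ x) q r)) (⊗-distribˡ p q r))
  (⊕-interchange (map (zipWith _+_ x) q) (map (zipWith _+_ x) r) (p ⊗ q) (p ⊗ r))

⊗-zeroʳ : (p : Poly k) → p ⊗ [] ≡ []
⊗-zeroʳ []      = refl
⊗-zeroʳ (x ∷ p) = ⊗-zeroʳ p

map-⊗ : (x : Monomial k) (q r : Poly k) →
        map (zipWith _+_ x) q ⊗ r ≡ map (zipWith _+_ x) (q ⊗ r)
map-⊗ x []      r = refl
map-⊗ x (y ∷ q) r = begin
  map (zipWith _+_ (zipWith _+_ x y)) r ++ map (zipWith _+_ x) q ⊗ r
    ≡⟨ cong₂ _++_ (trans (List.map-cong (Vec.zipWith-assoc ℕ.+-assoc x y) r) (List.map-∘ r)) (map-⊗ x q r) ⟩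
  map (zipWith _+_ x) (map (zipWith _+_ y) r) ++ map (zipWith _+_ x) (q ⊗ r)
    ≡⟨ List.map-++ (zipWith _+_ x) (map (zipWith _+_ y) r) (q ⊗ r) ⟨
  map (zipWith _+_ x) (map (zipWith _+_ y) r ++ q ⊗ r) ∎
  where open ≡-Reasoning

⊗-assoc : (p q r : Poly k) → (p ⊗ q) ⊗ r ≡ p ⊗ (q ⊗ r)
⊗-assoc []      q r = refl
⊗-assoc (x ∷ p) q r = trans
  (⊗-distribʳ r (map (zipWith _+_ x) q) (p ⊗ q))
  (cong₂ _++_ (map-⊗ x q r) (⊗-assoc p q r))

⊗-congʳ : {p p′ : Poly k} (q : Poly k) → p ≈ p′ → p ⊗ q ≈ p′ ⊗ q
⊗-congʳ q _↭_.refl        = ↭-refl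
⊗-congʳ q (prep x p≈)     = ++⁺ˡ (map (zipWith _+_ x) q) (⊗-congʳ q p≈)
⊗-congʳ q (swap {xs = p} {ys = p′} x y p≈) = begin
  xq ++ (yq ++ p ⊗ q)   ≡⟨ List.++-assoc xq yq (p ⊗ q) ⟨
  (xq ++ yq) ++ p ⊗ q   ↭⟨ ⊕-cong (++-comm xq yq) (⊗-congʳ q p≈) ⟩
  (yq ++ xq) ++ p′ ⊗ q  ≡⟨ List.++-assoc yq xq (p′ ⊗ q) ⟩
  yq ++ (xq ++ p′ ⊗ q)  ∎
  where
  open PermutationReasoning
  xq yq : Poly _
  xq = map (zipWith _+_ x) q
  yq = map (zipWith _+_ y) q
⊗-congʳ q (_↭_.trans p≈ p≈′) = ↭-trans (⊗-congʳ q p≈) (⊗-congʳ q p≈′)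

⊗-congˡ : (p : Poly k) {q q′ : Poly k} → q ≈ q′ → p ⊗ q ≈ p ⊗ q′
⊗-congˡ []      q≈ = ↭-refl
⊗-congˡ (x ∷ p) q≈ = ⊕-cong (map⁺ (zipWith _+_ x) q≈) (⊗-congˡ p q≈)

⊗-cong : {p p′ q q′ : Poly k} → p ≈ p′ → q ≈ q′ → p ⊗ q ≈ p′ ⊗ q′
⊗-cong {p′ = p′} {q = q} p≈ q≈ = ↭-trans (⊗-congʳ q p≈) (⊗-congˡ p′ q≈)

-- Finite sums of polynomials

sumOver : List A → (A → Poly k) → Poly k
sumOver xs f = ∑ (map f xs)

sumOver-cong : (xs : List A) {f g : A → Poly k} → (∀ x → f x ≈ g x) →
               sumOver xs f ≈ sumOver xs g
sumOver-cong []       f≈g = ↭-refl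
sumOver-cong (x ∷ xs) f≈g = ⊕-cong (f≈g x) (sumOver-cong xs f≈g)

sumOver-++ : (xs ys : List A) (f : A → Poly k) →
             sumOver (xs ++ ys) f ≡ sumOver xs f ⊕ sumOver ys f
sumOver-++ []       ys f = refl
sumOver-++ (x ∷ xs) ys f = trans (cong (f x ++_) (sumOver-++ xs ys f))
                                 (sym (List.++-assoc (f x) _ _))

sumOver-cartesianProductWith :
  {C : Set} (h : A → B → C) (xs : List A) (ys : List B) (f : C → Poly k) →
  sumOver (cartesianProductWith h xs ys) f ≡
  sumOver xs (λ x → sumOver ys (λ y → f (h x y)))
sumOver-cartesianProductWith h []       ys f = refl
sumOver-cartesianProductWith h (x ∷ xs) ys f = trans
  (sumOver-++ (map (h x) ys) (cartesianProductWith h xs ys) f)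
  (cong₂ _++_ (cong ∑ (sym (List.map-∘ ys))) (sumOver-cartesianProductWith h xs ys f))

sumOver-zero : (xs : List A) → sumOver {k = k} xs (λ _ → []) ≡ []
sumOver-zero []       = refl
sumOver-zero (x ∷ xs) = sumOver-zero xs

sumOver-⊕ : (xs : List A) (f g : A → Poly k) →
            sumOver xs (λ x → f x ⊕ g x) ≈ sumOver xs f ⊕ sumOver xs g
sumOver-⊕ []       f g = ↭-refl
sumOver-⊕ (x ∷ xs) f g = ↭-trans
  (⊕-cong (↭-refl {x = f x ⊕ g x}) (sumOver-⊕ xs f g))
  (⊕-interchange (f x) (g x) (sumOver xs f) (sumOver xs g))

sumOver-swap : (xs : List A) (ys : List B) (f : A → B → Poly k) →
               sumOver xs (λ x → sumOver ys (f x)) ≈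
               sumOver ys (λ y → sumOver xs (λ x → f x y))
sumOver-swap []       ys f = ≈-reflexive (sym (sumOver-zero ys))
sumOver-swap (x ∷ xs) ys f = ↭-trans
  (++⁺ˡ (sumOver ys (f x)) (sumOver-swap xs ys f))
  (↭-sym (sumOver-⊕ ys (f x) _))

sumOver-⊗ʳ : (xs : List A) (f : A → Poly k) (q : Poly k) →
             sumOver xs f ⊗ q ≡ sumOver xs (λ x → f x ⊗ q)
sumOver-⊗ʳ []       f q = refl
sumOver-⊗ʳ (x ∷ xs) f q = trans (⊗-distribʳ q (f x) (sumOver xs f))
                                (cong (f x ⊗ q ++_) (sumOver-⊗ʳ xs f q))

sumOver-⊗ˡ : (p : Poly k) (xs : List A) (f : A → Poly k) →
             p ⊗ sumOver xs f ≈ sumOver xs (λ x → p ⊗ f x)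
sumOver-⊗ˡ p []       f = ≈-reflexive (⊗-zeroʳ p)
sumOver-⊗ˡ p (x ∷ xs) f = ↭-trans (⊗-distribˡ p (f x) (sumOver xs f))
                                  (++⁺ˡ (p ⊗ f x) (sumOver-⊗ˡ p xs f))

-- The inner summation of a product runs over the list `indices`, which need
-- not exhaust X.

module Matrices {X : Set} (indices : List X) where

  infixr 7 _⋆_ _∙_

  _⋆_ : (X → X → Poly k) → (X → Poly k) → X → Poly k
  (M ⋆ v) p = sumOver indices (λ c → M p c ⊗ v c)

  _∙_ : (M N : X → X → Poly k) → X → X → Poly k
  (M ∙ N) p q = (M ⋆ (λ c → N c q)) p

  ⋆-congʳ : (M : X → X → Poly k) {v w : X → Poly k} → (∀ c → v c ≈ w c) →
            ∀ p → (M ⋆ v) p ≈ (M ⋆ w) p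
  ⋆-congʳ M v≈w p = sumOver-cong indices (λ c → ⊗-congˡ (M p c) (v≈w c))

  ⋆-assoc : (M N : X → X → Poly k) (v : X → Poly k) →
            ∀ p → ((M ∙ N) ⋆ v) p ≈ (M ⋆ (N ⋆ v)) p
  ⋆-assoc M N v p = begin
    sumOver indices (λ d → sumOver indices (λ c → M p c ⊗ N c d) ⊗ v d)
      ↭⟨ sumOver-cong indices (λ d → ≈-reflexive (sumOver-⊗ʳ indices _ (v d))) ⟩
    sumOver indices (λ d → sumOver indices (λ c → (M p c ⊗ N c d) ⊗ v d))
      ↭⟨ sumOver-swap indices indices _ ⟩
    sumOver indices (λ c → sumOver indices (λ d → (M p c ⊗ N c d) ⊗ v d))
      ↭⟨ sumOver-cong indices (λ c → sumOver-cong indices (λ d → ≈-reflexive (⊗-assoc (M p c) (N c d) (v d)))) ⟩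
    sumOver indices (λ c → sumOver indices (λ d → M p c ⊗ (N c d ⊗ v d)))
      ↭⟨ sumOver-cong indices (λ c → ↭-sym (sumOver-⊗ˡ (M p c) indices _)) ⟩
    sumOver indices (λ c → M p c ⊗ (N ⋆ v) c) ∎
    where open PermutationReasoning

  -- `power M n` is the (n + 1)-st power: no identity matrix is needed.
  power : (X → X → Poly k) → ℕ → X → X → Poly k
  power M zero    = M
  power M (suc n) = M ∙ power M n

  power-+ : (M : X → X → Poly k) (m n : ℕ) →
            ∀ p q → power M (suc (m + n)) p q ≈ (power M m ∙ power M n) p q
  power-+ M zero    n p q = ↭-refl
  power-+ M (suc m) n p q = ↭-trans
    (⋆-congʳ M (λ c → power-+ M m n c q) p)
    (↭-sym (⋆-assoc M (power M m) (λ c → power M n c q) p))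

-- Circuits

AnyCircuit : ℕ → Set
AnyCircuit k = ∃ (Circuit k)

size : AnyCircuit k → ℕ
size = proj₁

eval : (C : AnyCircuit k) → Source k (size C) → Poly k
eval (_ , c) = evalSource (gateValues c)

-- The zero polynomial counts as known although no circuit computes it, since
-- scalars are positive; it costs nothing because 0 ⊕ p and 0 ⊗ p need no gate.

data Known (C : AnyCircuit k) (p : Poly k) : Set where
  vanishes : p ≈ [] → Known C p
  computed : (s : Source k (size C)) → eval C s ≈ p → Known C p

Known-resp : {C : AnyCircuit k} {p q : Poly k} → p ≈ q → Known C p → Known C q
Known-resp p≈q (vanishes p≈0)   = vanishes (↭-trans (↭-sym p≈q) p≈0)
Known-resp p≈q (computed s s≈p) = computed s (↭-trans s≈p p≈q)

Known-▷ : {c : Circuit k n} {g : Gate k n} {p : Poly k} →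
          Known (n , c) p → Known (suc n , c ▷ g) p
Known-▷ (vanishes p≈0)           = vanishes p≈0
Known-▷ (computed (input i) s≈p) = computed (input i) s≈p
Known-▷ (computed (const c) s≈p) = computed (const c) s≈p
Known-▷ (computed (gate i) s≈p)  = computed (gate (suc i)) s≈p

infix 4 _≼_

_≼_ : AnyCircuit k → AnyCircuit k → Set
C ≼ D = ∀ {p} → Known C p → Known D p

-- A graded state monad: some circuit with at most `cost` more gates loses no known polynomial and
-- satisfies Q; `bind` adds costs. Speaking of known polynomials instead of gates hides the
-- renumbering that each new gate causes.
record Reach (C : AnyCircuit k) (cost : ℕ) (Q : AnyCircuit k → Set) : Set where
  constructor reach
  field
    target : AnyCircuit k
    size≤  : size target ≤ cost + size C
    keeps  : C ≼ target
    holds  : Q target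

open Reach

private
  variable
    C D : AnyCircuit k
    Q R : AnyCircuit k → Set
    cost cost′ : ℕ

stay : Q C → Reach C cost Q
stay {C = C} {cost = cost} q = reach C (ℕ.m≤n+m (size C) cost) id q

Reach-≤ : cost ≤ cost′ → Reach C cost Q → Reach C cost′ Q
Reach-≤ {C = C} cost≤ (reach D D≤ C≼D q) =
  reach D (ℕ.≤-trans D≤ (ℕ.+-monoˡ-≤ (size C) cost≤)) C≼D q

Reach-map : (∀ {D} → C ≼ D → Q D → R D) → Reach C cost Q → Reach C cost R
Reach-map f (reach D D≤ C≼D q) = reach D D≤ C≼D (f C≼D q)

bind : Reach C cost Q → (∀ {D} → C ≼ D → Q D → Reach D cost′ R) → Reach C (cost + cost′) R
bind {C = C} {cost = cost} {cost′ = cost′} (reach D D≤ C≼D q) f with f C≼D q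
... | reach E E≤ D≼E r = reach E E≤C (D≼E ∘ C≼D) r
  where
  open ℕ.≤-Reasoning
  E≤C : size E ≤ (cost + cost′) + size C
  E≤C = begin
    size E              ≤⟨ E≤ ⟩
    cost′ + size D          ≤⟨ ℕ.+-monoʳ-≤ cost′ D≤ ⟩
    cost′ + (cost + size C)    ≡⟨ ℕ.+-assoc cost′ cost (size C) ⟨
    (cost′ + cost) + size C    ≡⟨ cong (_+ size C) (ℕ.+-comm cost′ cost) ⟩
    (cost + cost′) + size C    ∎

reach-⊕ : {p q : Poly k} → Known C p → Known C q → Reach C 1 (λ D → Known D (p ⊕ q))
reach-⊕ {p = p} {q} (vanishes p≈0) Kq =
  stay (Known-resp (↭-sym (⊕-cong p≈0 (↭-refl {x = q}))) Kq)
reach-⊕ {p = p} Kp@(computed _ _) (vanishes q≈0) =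
  stay (Known-resp (↭-trans (≈-reflexive (sym (List.++-identityʳ p)))
                            (⊕-cong (↭-refl {x = p}) (↭-sym q≈0))) Kp)
reach-⊕ {C = n , c} (computed s s≈p) (computed t t≈q) =
  reach (suc n , c ▷ add s t) ℕ.≤-refl Known-▷ (computed (gate zero) (⊕-cong s≈p t≈q))

reach-⊗ : {p q : Poly k} → Known C p → Known C q → Reach C 1 (λ D → Known D (p ⊗ q))
reach-⊗ {q = q} (vanishes p≈0) _ = stay (vanishes (⊗-congʳ q p≈0))
reach-⊗ {p = p} (computed _ _) (vanishes q≈0) =
  stay (vanishes (↭-trans (⊗-congˡ p q≈0) (≈-reflexive (⊗-zeroʳ p))))
reach-⊗ {C = n , c} (computed s s≈p) (computed t t≈q) =
  reach (suc n , c ▷ mul s t) ℕ.≤-refl Known-▷ (computed (gate zero) (⊗-cong s≈p t≈q))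

Known-one : {C : AnyCircuit k} → Known C (scalar 1)
Known-one = computed (const 1) ↭-refl

reach-∏var : (is : List (Fin k)) → Reach C (length is) (λ D → Known D (∏ (map var is)))
reach-∏var []       = stay Known-one
reach-∏var (i ∷ is) = Reach-≤ (ℕ.≤-reflexive (ℕ.+-comm (length is) 1))
  (bind (reach-∏var is) (λ _ K → reach-⊗ (computed (input i) ↭-refl) K))

reach-sumProduct : {f g : A → Poly k} → (∀ x → Known C (f x)) → (∀ x → Known C (g x)) →
  (xs : List A) → Reach C (length xs * 2) (λ D → Known D (sumOver xs (λ x → f x ⊗ g x)))
reach-sumProduct Kf Kg []       = stay (vanishes ↭-refl)
reach-sumProduct Kf Kg (x ∷ xs) = Reach-≤ (ℕ.≤-reflexive (ℕ.+-comm (length xs * 2) 2))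
  (bind (reach-sumProduct Kf Kg xs) (λ C≼D Kxs →
    bind (reach-⊗ (C≼D (Kf x)) (C≼D (Kg x))) (λ D≼E Kx → reach-⊕ Kx (D≼E Kxs))))

-- The hypothesis ranges over all later circuits D because each member is computed on top of the
-- gates already spent on the others.
reach-family : (f : A → Poly k) (xs : List A) →
  (∀ {D} → C ≼ D → ∀ x → Reach D cost (λ E → Known E (f x))) →
  Reach C (length xs * cost) (λ D → ∀ {x} → x ∈ xs → Known D (f x))
reach-family f []       r = stay (λ ())
reach-family {C = C} {cost = cost} f (x ∷ xs) r =
  bind (r id x) λ C≼D Kx →
    Reach-map (λ D≼E Kxs → λ { (here refl) → D≼E Kx ; (there x∈) → Kxs x∈ })
      (reach-family f xs (λ D≼E → r (D≼E ∘ C≼D)))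

-- Gate counts for matrix products and powers

length-cartesianProductWith : {C : Set} (f : A → B → C) (xs : List A) (ys : List B) →
                              length (cartesianProductWith f xs ys) ≡ length xs * length ys
length-cartesianProductWith f []       ys = refl
length-cartesianProductWith f (x ∷ xs) ys = trans (List.length-++ (map (f x) ys))
  (cong₂ _+_ (List.length-map (f x) ys) (length-cartesianProductWith f xs ys))

-- The split follows the exponent n + 1 of `power M n`: it is 2(h + 1) for `odd h` and 2(h + 1) + 1
-- for `even h`.
data Parity : ℕ → Set where
  zero : Parity 0
  odd  : ∀ h → Parity (suc (h + h))
  even : ∀ h → Parity (suc (suc (h + h)))

parity : ∀ n → Parity n
parity zero    = zero
parity (suc n) with parity n
... | zero   = odd 0
... | odd h  = even h
... | even h = subst Parity (cong (2 +_) (ℕ.+-suc h h)) (odd (suc h))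

double-< : ∀ {m n t} → suc (m + m) ≤ n → suc n < 2 ^ suc t → suc m < 2 ^ t
double-< {m} {n} {t} 2m<n n<2^t = ℕ.*-cancelˡ-< 2 (suc m) (2 ^ t)
  (ℕ.≤-<-trans (ℕ.≤-trans (ℕ.≤-reflexive eq) (s≤s 2m<n)) n<2^t)
  where
  eq : 2 * suc m ≡ suc (suc (m + m))
  eq = cong suc (trans (ℕ.+-suc m (m + 0)) (cong (suc m +_) (ℕ.+-identityʳ m)))

-- `states` lists all positions at which vectors and matrices must be known, and stays the same from
-- block to block; `indices` lists the columns over which the products of one block sum.
module MatrixCircuits {X : Set} (states indices : List X) (∈-states : ∀ x → x ∈ states) where

  open Matrices indices

  reach-vector : (v : X → Poly k) →
    (∀ {D} → C ≼ D → ∀ p → Reach D cost (λ E → Known E (v p))) →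
    Reach C (length states * cost) (λ D → ∀ p → Known D (v p))
  reach-vector v r = Reach-map (λ _ K p → K (∈-states p)) (reach-family v states r)

  reach-matrix : (M : X → X → Poly k) →
    (∀ {D} → C ≼ D → ∀ p q → Reach D cost (λ E → Known E (M p q))) →
    Reach C (length states * length states * cost) (λ D → ∀ p q → Known D (M p q))
  reach-matrix {cost = cost} M r =
    Reach-≤ (ℕ.≤-reflexive (cong (_* cost) (length-cartesianProductWith _,_ states states)))
      (Reach-map (λ _ K p q → K (∈-cartesianProduct⁺ (∈-states p) (∈-states q)))
        (reach-family (uncurry M) (cartesianProduct states states) (λ C≼D → uncurry (r C≼D))))

  reach-⋆ : {M : X → X → Poly k} {v : X → Poly k} →
    (∀ p q → Known C (M p q)) → (∀ p → Known C (v p)) →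
    Reach C (length states * (length indices * 2)) (λ D → ∀ p → Known D ((M ⋆ v) p))
  reach-⋆ KM Kv = reach-vector _ (λ C≼D p →
    reach-sumProduct (λ c → C≼D (KM p c)) (λ c → C≼D (Kv c)) indices)

  productCost : ℕ
  productCost = length states * length states * (length indices * 2)

  reach-∙ : {M N : X → X → Poly k} →
    (∀ p q → Known C (M p q)) → (∀ p q → Known C (N p q)) →
    Reach C productCost (λ D → ∀ p q → Known D ((M ∙ N) p q))
  reach-∙ KM KN = reach-matrix _ (λ C≼D p q →
    reach-sumProduct (λ c → C≼D (KM p c)) (λ c → C≼D (KN c q)) indices)

  -- Each round halves the exponent n + 1 by one squaring and at most one multiplication by M, hence
  -- two products; after t rounds a number below 2^(t + 1) has come down to 1.
  reach-power : {M : X → X → Poly k} → (∀ p q → Known C (M p q)) →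
    ∀ t n → suc n < 2 ^ suc t →
    Reach C (t * (productCost + productCost)) (λ D → ∀ p q → Known D (power M n p q))
  reach-power KM zero    zero    _  = stay KM
  reach-power KM zero    (suc n) n< = contradiction n< (ℕ.≤⇒≯ (s≤s (s≤s z≤n)))
  reach-power {C = C} {M = M} KM (suc t) n n< = Reach-≤ (ℕ.≤-reflexive (ℕ.+-comm (t * _) _)) (go (parity n) n<)
    where
    square : ∀ h → suc h < 2 ^ suc t →
      Reach C (t * (productCost + productCost) + productCost)
        (λ D → ∀ p q → Known D (power M (suc (h + h)) p q))
    square h h< = bind (reach-power KM t h h<) (λ _ Kh →
      Reach-map (λ _ K p q → Known-resp (↭-sym (power-+ M h h p q)) (K p q)) (reach-∙ Kh Kh))

    go : ∀ {n} → Parity n → suc n < 2 ^ suc (suc t) →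
      Reach C (t * (productCost + productCost) + (productCost + productCost))
        (λ D → ∀ p q → Known D (power M n p q))
    go zero     n< = stay KM
    go (odd h)  n< = Reach-≤ (ℕ.+-monoʳ-≤ (t * _) (ℕ.m≤m+n productCost productCost))
      (square h (double-< {t = suc t} ℕ.≤-refl n<))
    go (even h) n< = Reach-≤ (ℕ.≤-reflexive (ℕ.+-assoc (t * _) productCost productCost))
      (bind (square h (double-< {t = suc t} (ℕ.n≤1+n _) n<)) (λ C≼D K → reach-∙ (λ p q → C≼D (KM p q)) K))

-- Columns of tableaux

data Cell {A : Set} : Vec A m → ℕ → A → Set where
  here  : {x : A} {r : Vec A m} → Cell (x ∷ r) 0 x
  there : ∀ {x y : A} {r : Vec A m} {j} → Cell r j x → Cell (y ∷ r) (suc j) x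

cell-lookup : (r : Vec A m) (j : Fin m) → Cell r (toℕ j) (lookup r j)
cell-lookup (x ∷ r) zero    = here
cell-lookup (x ∷ r) (suc j) = there (cell-lookup r j)

cell⇒lookup : ∀ {r : Vec A m} {j a} → Cell r j a → ∃ λ (i : Fin m) → toℕ i ≡ j × lookup r i ≡ a
cell⇒lookup here = zero , refl , refl
cell⇒lookup (there c) with cell⇒lookup c
... | i , i≡j , r≡a = suc i , cong suc i≡j , r≡a

-- `pred` keeps an empty row empty, so such a row discards `a`. Once the discarded entries are
-- fixed, as in `choices`, gluing is a bijection from pairs (first column, remainder) to fillings.
glueRow : ∀ m → A → Vec A (pred m) → Vec A m
glueRow zero    a r = []
glueRow (suc m) a r = a ∷ r

glue : (μ : Vec ℕ ℓ) → Vec (Fin k) ℓ → Filling k (Vec.map pred μ) → Filling k μ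
glue []      []      []      = []
glue (m ∷ μ) (a ∷ c) (r ∷ T) = glueRow m a r ∷ glue μ c T

active : ℕ → Bool
active zero    = false
active (suc m) = true

support : Vec ℕ ℓ → Vec Bool ℓ
support = Vec.map active

module _ {k : ℕ} where

  glue-here⁻ : (μ : Vec ℕ ℓ) (c : Vec (Fin k) ℓ) (T : Filling k (Vec.map pred μ)) (i : Fin ℓ) →
    ∀ {a} → Cell (lookup⁺ (glue μ c T) i) 0 a → lookup (support μ) i ≡ true × lookup c i ≡ a
  glue-here⁻ (zero  ∷ μ) (_ ∷ c) (r ∷ T) zero    ()
  glue-here⁻ (suc m ∷ μ) (_ ∷ c) (r ∷ T) zero    here = refl , refl
  glue-here⁻ (m     ∷ μ) (_ ∷ c) (r ∷ T) (suc i) cell = glue-here⁻ μ c T i cell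

  glue-here⁺ : (μ : Vec ℕ ℓ) (c : Vec (Fin k) ℓ) (T : Filling k (Vec.map pred μ)) (i : Fin ℓ) →
    lookup (support μ) i ≡ true → Cell (lookup⁺ (glue μ c T) i) 0 (lookup c i)
  glue-here⁺ (suc m ∷ μ) (_ ∷ c) (r ∷ T) zero    _  = here
  glue-here⁺ (m     ∷ μ) (_ ∷ c) (r ∷ T) (suc i) on = glue-here⁺ μ c T i on

  glue-there⁻ : (μ : Vec ℕ ℓ) (c : Vec (Fin k) ℓ) (T : Filling k (Vec.map pred μ)) (i : Fin ℓ) →
    ∀ {j a} → Cell (lookup⁺ (glue μ c T) i) (suc j) a → Cell (lookup⁺ T i) j a
  glue-there⁻ (zero  ∷ μ) (_ ∷ c) (r ∷ T) zero    ()
  glue-there⁻ (suc m ∷ μ) (_ ∷ c) (r ∷ T) zero    (there cell) = cell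
  glue-there⁻ (m     ∷ μ) (_ ∷ c) (r ∷ T) (suc i) cell = glue-there⁻ μ c T i cell

  glue-there⁺ : (μ : Vec ℕ ℓ) (c : Vec (Fin k) ℓ) (T : Filling k (Vec.map pred μ)) (i : Fin ℓ) →
    ∀ {j a} → Cell (lookup⁺ T i) j a → Cell (lookup⁺ (glue μ c T) i) (suc j) a
  glue-there⁺ (zero  ∷ μ) (_ ∷ c) ([] ∷ T) zero   ()
  glue-there⁺ (suc m ∷ μ) (_ ∷ c) (r ∷ T) zero    cell = there cell
  glue-there⁺ (m     ∷ μ) (_ ∷ c) (r ∷ T) (suc i) cell = glue-there⁺ μ c T i cell

  rowCell : {μ : Vec ℕ ℓ} (T : Filling k μ) (i : Fin ℓ) → ℕ → Fin k → Set
  rowCell T i = Cell (lookup⁺ T i)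

  -- The conditions of a tableau in terms of cells with unbounded column index:
  -- unlike `Fin (lookup μ i)`, ℕ does not change when a column is removed.

  CellRows CellColumns : {μ : Vec ℕ ℓ} → Filling k μ → Set
  CellRows T = ∀ i {j a b} → rowCell T i j a → rowCell T i (suc j) b → a Fin.≤ b
  CellColumns T = ∀ i i′ → toℕ i′ ≡ suc (toℕ i) → ∀ {j a b} →
    rowCell T i j a → rowCell T i′ j b → a Fin.< b

  CellBelow : {μ : Vec ℕ ℓ} → Vec (Fin k) ℓ → Filling k μ → Set
  CellBelow p T = ∀ i {a} → rowCell T i 0 a → lookup p i Fin.≤ a

  CellFits : {μ : Vec ℕ ℓ} → Vec (Fin k) ℓ → Filling k μ → Set
  CellFits p T = (CellRows T × CellColumns T) × CellBelow p T

  Below : {μ : Vec ℕ ℓ} → Vec (Fin k) ℓ → Filling k μ → Set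
  Below {μ = μ} p T = ∀ i (j : Fin (lookup μ i)) → toℕ j ≡ 0 → lookup p i Fin.≤ entry T i j

  Fits : {μ : Vec ℕ ℓ} → Vec (Fin k) ℓ → Filling k μ → Set
  Fits p T = IsSemistandard T × Below p T

  fits? : {μ : Vec ℕ ℓ} (p : Vec (Fin k) ℓ) (T : Filling k μ) → Dec (Fits p T)
  fits? p T = isSemistandard? T ×-dec
    (Fin.all? λ i → Fin.all? λ j → (toℕ j ℕ.≟ 0) →-dec (lookup p i Fin.≤? entry T i j))

  module _ {μ : Vec ℕ ℓ} (T : Filling k μ) where

    entryCell : ∀ i j {n} → toℕ j ≡ n → rowCell T i n (entry T i j)
    entryCell i j refl = cell-lookup (lookup⁺ T i) j

    semistandard⇔cells : IsSemistandard T ⇔ (CellRows T × CellColumns T)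
    semistandard⇔cells = mk⇔
      (λ (rows , columns) →
        (λ i x y → cellRows rows i (cell⇒lookup x) (cell⇒lookup y)) ,
        (λ i i′ i′≡ x y → cellColumns columns i i′ i′≡ (cell⇒lookup x) (cell⇒lookup y)))
      (λ (rows , columns) →
        (λ i j j′ j′≡ → rows i (entryCell i j refl) (entryCell i j′ j′≡)) ,
        (λ i i′ i′≡ j j′ j′≡ → columns i i′ i′≡ (entryCell i j refl) (entryCell i′ j′ j′≡)))
      where
      cellRows : RowsWeak T → ∀ i {j a b} →
        (∃ λ x → toℕ x ≡ j × entry T i x ≡ a) →
        (∃ λ y → toℕ y ≡ suc j × entry T i y ≡ b) → a Fin.≤ b
      cellRows rows i (x , refl , refl) (y , y≡ , refl) = rows i x y y≡

      cellColumns : ColumnsStrict T → ∀ i i′ → toℕ i′ ≡ suc (toℕ i) → ∀ {j a b} →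
        (∃ λ x → toℕ x ≡ j × entry T i x ≡ a) →
        (∃ λ y → toℕ y ≡ j × entry T i′ y ≡ b) → a Fin.< b
      cellColumns columns i i′ i′≡ (x , refl , refl) (y , y≡ , refl) =
        columns i i′ i′≡ x y y≡

    fits⇔cells : ∀ p → Fits p T ⇔ CellFits p T
    fits⇔cells p = mk⇔
      (λ (ss , below) → Equivalence.to semistandard⇔cells ss ,
        λ i x → cellBelow below i (cell⇒lookup x))
      (λ (cells , below) → Equivalence.from semistandard⇔cells cells ,
        λ i j j≡0 → below i (entryCell i j j≡0))
      where
      cellBelow : Below p T → ∀ i {a} → (∃ λ x → toℕ x ≡ 0 × entry T i x ≡ a) →
        lookup p i Fin.≤ a
      cellBelow below i (x , x≡0 , refl) = below i x x≡0

  -- c may follow p as a column of a tableau in which the rows marked by b are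
  -- the ones long enough to meet c.

  Step : Vec Bool ℓ → Vec (Fin k) ℓ → Vec (Fin k) ℓ → Set
  Step b p c =
    (∀ i → lookup b i ≡ true → lookup p i Fin.≤ lookup c i) ×
    (∀ i i′ → toℕ i′ ≡ suc (toℕ i) → lookup b i ≡ true → lookup b i′ ≡ true →
      lookup c i Fin.< lookup c i′)

  step? : (b : Vec Bool ℓ) (p c : Vec (Fin k) ℓ) → Dec (Step b p c)
  step? b p c =
    (Fin.all? λ i → (lookup b i Bool.≟ true) →-dec (lookup p i Fin.≤? lookup c i))
    ×-dec
    (Fin.all? λ i → Fin.all? λ i′ → (toℕ i′ ℕ.≟ suc (toℕ i)) →-dec
      ((lookup b i Bool.≟ true) →-dec ((lookup b i′ Bool.≟ true) →-dec
        (lookup c i Fin.<? lookup c i′))))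

  -- Column 0 of the glued filling is c, and column j + 1 is column j of T. The row condition thus
  -- splits into the pair of columns 0 and 1, which is `CellBelow c T`, and the pairs inside T;
  -- strictness splits column by column, column 0 going to `Step`.
  cellFits-glue⇔ : (μ : Vec ℕ ℓ) (p c : Vec (Fin k) ℓ) (T : Filling k (Vec.map pred μ)) →
    CellFits p (glue μ c T) ⇔ (Step (support μ) p c × CellFits c T)
  cellFits-glue⇔ μ p c T = mk⇔
    (λ ((rows , columns) , below) →
      ((λ i on → below i (glue-here⁺ μ c T i on)) ,
       (λ i i′ i′≡ on on′ → columns i i′ i′≡ (glue-here⁺ μ c T i on) (glue-here⁺ μ c T i′ on′))) ,
      ((λ i x y → rows i (glue-there⁺ μ c T i x) (glue-there⁺ μ c T i y)) ,
       (λ i i′ i′≡ x y → columns i i′ i′≡ (glue-there⁺ μ c T i x) (glue-there⁺ μ c T i′ y))) ,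
      -- A cell in column 0 of T moves to column 1, so its row meets c and `lookup c i` is its left
      -- neighbour.
      (λ i x → rows i (glue-here⁺ μ c T i (on-support i x)) (glue-there⁺ μ c T i x)))
    (λ ((p≤c , strict) , ((rows , columns) , below)) →
      ((λ i {j} → gluedRows rows below i {j}) , (λ i i′ i′≡ {j} → gluedColumns strict columns i i′ i′≡ {j})) ,
      (λ i x → gluedBelow p≤c i (glue-here⁻ μ c T i x)))
    where
    on-support′ : ∀ {ℓ} (μ : Vec ℕ ℓ) (T : Filling k (Vec.map pred μ)) i {j a} →
      rowCell T i j a → lookup (support μ) i ≡ true
    on-support′ (zero  ∷ μ) ([] ∷ T) zero    ()
    on-support′ (suc m ∷ μ) (r ∷ T)  zero    x = refl
    on-support′ (m     ∷ μ) (r ∷ T)  (suc i) x = on-support′ μ T i x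

    on-support : ∀ i {j a} → rowCell T i j a → lookup (support μ) i ≡ true
    on-support = on-support′ μ T

    gluedBelow : (∀ i → lookup (support μ) i ≡ true → lookup p i Fin.≤ lookup c i) →
      ∀ i {a} → lookup (support μ) i ≡ true × lookup c i ≡ a → lookup p i Fin.≤ a
    gluedBelow p≤c i (on , refl) = p≤c i on

    gluedRows : CellRows T → CellBelow c T → CellRows (glue μ c T)
    gluedRows rows below i {zero} x y with refl ← proj₂ (glue-here⁻ μ c T i x) =
      below i (glue-there⁻ μ c T i y)
    gluedRows rows below i {suc j} x y =
      rows i (glue-there⁻ μ c T i x) (glue-there⁻ μ c T i y)

    gluedColumns : (∀ i i′ → toℕ i′ ≡ suc (toℕ i) → lookup (support μ) i ≡ true →
        lookup (support μ) i′ ≡ true → lookup c i Fin.< lookup c i′) →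
      CellColumns T → CellColumns (glue μ c T)
    gluedColumns strict columns i i′ i′≡ {zero} x y
      with on , refl ← glue-here⁻ μ c T i x | on′ , refl ← glue-here⁻ μ c T i′ y =
      strict i i′ i′≡ on on′
    gluedColumns strict columns i i′ i′≡ {suc j} x y =
      columns i i′ i′≡ (glue-there⁻ μ c T i x) (glue-there⁻ μ c T i′ y)

  fits-glue⇔ : (μ : Vec ℕ ℓ) (p c : Vec (Fin k) ℓ) (T : Filling k (Vec.map pred μ)) →
    Fits p (glue μ c T) ⇔ (Step (support μ) p c × Fits c T)
  fits-glue⇔ μ p c T = mk⇔
    (λ fits → let step , cells = to (cellFits-glue⇔ μ p c T) (to (fits⇔cells (glue μ c T) p) fits)
              in step , from (fits⇔cells T c) cells)
    (λ (step , fits) → from (fits⇔cells (glue μ c T) p)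
      (from (cellFits-glue⇔ μ p c T) (step , to (fits⇔cells T c) fits)))
    where open Equivalence

-- The transfer matrix

weight : List (Fin k) → Poly k
weight is = ∏ (map var is)

⊗-identityˡ : (p : Poly k) → scalar 1 ⊗ p ≡ p
⊗-identityˡ p = trans (List.++-identityʳ _)
  (trans (List.map-cong (Vec.zipWith-identityˡ ℕ.+-identityˡ) p) (List.map-id p))

var-comm : (i j : Fin k) → var i ⊗ var j ≡ var j ⊗ var i
var-comm i j = cong [_] (Vec.zipWith-comm ℕ.+-comm _ _)

weight-↭ : {is js : List (Fin k)} → is ↭ js → weight is ≈ weight js
weight-↭ _↭_.refl           = ↭-refl
weight-↭ (prep i is↭js)     = ⊗-congˡ (var i) (weight-↭ is↭js)
weight-↭ (swap {xs = is} {ys = js} i j is↭js) = begin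
  var i ⊗ (var j ⊗ weight is)  ≡⟨ ⊗-assoc (var i) (var j) (weight is) ⟨
  (var i ⊗ var j) ⊗ weight is  ≡⟨ cong (_⊗ weight is) (var-comm i j) ⟩
  (var j ⊗ var i) ⊗ weight is  ≡⟨ ⊗-assoc (var j) (var i) (weight is) ⟩
  var j ⊗ (var i ⊗ weight is)  ↭⟨ ⊗-congˡ (var j) (⊗-congˡ (var i) (weight-↭ is↭js)) ⟩
  var j ⊗ (var i ⊗ weight js)  ∎
  where open PermutationReasoning
weight-↭ (_↭_.trans p q)    = ↭-trans (weight-↭ p) (weight-↭ q)

weight-++ : (is js : List (Fin k)) → weight (is ++ js) ≡ weight is ⊗ weight js
weight-++ []       js = sym (⊗-identityˡ (weight js))
weight-++ (i ∷ is) js = trans (cong (var i ⊗_) (weight-++ is js))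
                              (sym (⊗-assoc (var i) (weight is) (weight js)))

columnEntries : Vec Bool ℓ → Vec A ℓ → List A
columnEntries []          []      = []
columnEntries (true  ∷ b) (a ∷ c) = a ∷ columnEntries b c
columnEntries (false ∷ b) (a ∷ c) = columnEntries b c

length-columnEntries : (b : Vec Bool ℓ) (c : Vec A ℓ) → length (columnEntries b c) ≤ ℓ
length-columnEntries []          []      = z≤n
length-columnEntries (true  ∷ b) (a ∷ c) = s≤s (length-columnEntries b c)
length-columnEntries (false ∷ b) (a ∷ c) = ℕ.m≤n⇒m≤1+n (length-columnEntries b c)

entries-glue : (μ : Vec ℕ ℓ) (c : Vec (Fin k) ℓ) (T : Filling k (Vec.map pred μ)) →
               entries (glue μ c T) ↭ columnEntries (support μ) c ++ entries T
entries-glue []          []      []       = ↭-refl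
entries-glue (zero  ∷ μ) (a ∷ c) ([] ∷ T) = entries-glue μ c T
entries-glue (suc m ∷ μ) (a ∷ c) (r ∷ T)  = prep a (↭-trans
  (++⁺ˡ (toList r) (entries-glue μ c T))
  (shifts (toList r) (columnEntries (support μ) c)))

-- Using only `does` makes equivalent propositions with unrelated decision procedures give equal
-- polynomials.
when : Dec A → Poly k → Poly k
when d p = if does d then p else []

when-⇔ : A ⇔ B → (a? : Dec A) (b? : Dec B) (p : Poly k) → when a? p ≡ when b? p
when-⇔ A⇔B a? b? p = cong (if_then p else []) (does-⇔ A⇔B a? b?)

when-cong : (a? : Dec A) {p q : Poly k} → p ≈ q → when a? p ≈ when a? q
when-cong (yes _) p≈q = p≈q
when-cong (no  _) p≈q = ↭-refl

when-⊗ : (a? : Dec A) (b? : Dec B) (p q : Poly k) →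
         when (a? ×-dec b?) (p ⊗ q) ≡ when a? p ⊗ when b? q
when-⊗ (yes _) (yes _) p q = refl
when-⊗ (yes _) (no  _) p q = sym (⊗-zeroʳ p)
when-⊗ (no  _) b?      p q = refl

sumOver-filter : {P : A → Set} (P? : ∀ x → Dec (P x)) (f : A → Poly k) (xs : List A) →
                 sumOver (filter P? xs) f ≡ sumOver xs (λ x → when (P? x) (f x))
sumOver-filter P? f []       = refl
sumOver-filter P? f (x ∷ xs) with P? x
... | yes _ = cong (f x ++_) (sumOver-filter P? f xs)
... | no  _ = sumOver-filter P? f xs

-- A column keeps one entry per row; below the end of the column the entry is
-- zero by convention.

choices : Bool → List (Fin (suc k))
choices true  = allFin _
choices false = [ zero ]

columns : Vec Bool ℓ → List (Vec (Fin (suc k)) ℓ)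
columns []      = [ [] ]
columns (a ∷ b) = cartesianProductWith _∷_ (choices a) (columns b)

sumOver-allRows : ∀ m (f : Vec (Fin (suc k)) m → Poly n) →
  sumOver (allRows (suc k) m) f ≡
  sumOver (choices (active m)) (λ a → sumOver (allRows (suc k) (pred m)) (λ r → f (glueRow m a r)))
sumOver-allRows zero    f = sym (List.++-identityʳ _)
sumOver-allRows (suc m) f = sumOver-cartesianProductWith _∷_ (allFin _) (allRows _ m) f

-- By induction on the rows, each row giving its head to c and its tail to T. Collecting the heads
-- exchanges the sum over the first tail with the sum over the other heads, which reorders
-- monomials.
sumOver-allFillings : (μ : Vec ℕ ℓ) (f : Filling (suc k) μ → Poly n) →
  sumOver (allFillings (suc k) μ) f ≈
  sumOver (columns (support μ)) (λ c → sumOver (allFillings (suc k) (Vec.map pred μ)) (λ T → f (glue μ c T)))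
sumOver-allFillings []      f = ≈-reflexive (sym (List.++-identityʳ _))
sumOver-allFillings {k = k} (m ∷ μ) f = begin
  sumOver (allFillings K (m ∷ μ)) f
    ≡⟨ sumOver-cartesianProductWith _∷_ (allRows K m) (allFillings K μ) f ⟩
  sumOver (allRows K m) (λ r → sumOver (allFillings K μ) (λ T → f (r ∷ T)))
    ≡⟨ sumOver-allRows m _ ⟩
  sumOver as (λ a → sumOver rs (λ r → sumOver (allFillings K μ) (λ T → f (glueRow m a r ∷ T))))
    ↭⟨ sumOver-cong as (λ a → sumOver-cong rs (λ r → sumOver-allFillings μ _)) ⟩
  sumOver as (λ a → sumOver rs (λ r → sumOver cs (λ c → sumOver Ts (λ T → f (glueRow m a r ∷ glue μ c T)))))
    ↭⟨ sumOver-cong as (λ a → sumOver-swap rs cs _) ⟩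
  sumOver as (λ a → sumOver cs (λ c → sumOver rs (λ r → sumOver Ts (λ T → f (glueRow m a r ∷ glue μ c T)))))
    ↭⟨ sumOver-cong as (λ a → sumOver-cong cs (λ c → ≈-reflexive (sym (sumOver-cartesianProductWith _∷_ rs Ts _)))) ⟩
  sumOver as (λ a → sumOver cs (λ c → sumOver (allFillings K (Vec.map pred (m ∷ μ))) (λ T → f (glue (m ∷ μ) (a ∷ c) T))))
    ≡⟨ sumOver-cartesianProductWith _∷_ as cs _ ⟨
  sumOver (columns (support (m ∷ μ))) (λ c → sumOver (allFillings K (Vec.map pred (m ∷ μ))) (λ T → f (glue (m ∷ μ) c T))) ∎
  where
  open PermutationReasoning
  K = suc k
  as = choices {k} (active m)
  rs = allRows K (pred m)
  cs = columns {k = k} (support μ)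
  Ts = allFillings K (Vec.map pred μ)

module _ {k : ℕ} where

  schurAfter : Vec (Fin k) ℓ → Vec ℕ ℓ → Poly k
  schurAfter p μ = sumOver (allFillings k μ) (λ T → when (fits? p T) (weight (entries T)))

  transfer : Vec Bool ℓ → Vec (Fin k) ℓ → Vec (Fin k) ℓ → Poly k
  transfer b p c = when (step? b p c) (weight (columnEntries b c))

module _ {k : ℕ} where

  private
    K : ℕ
    K = suc k

  open module Product {ℓ} (b : Vec Bool ℓ) = Matrices (columns {k = k} b)

  -- `fits-glue⇔` separates the condition into one on p and c and one on c and T, and weights are
  -- multiplicative, so the transfer entry factors out of the sum over T.
  schurAfter-peel : (μ : Vec ℕ ℓ) (p : Vec (Fin K) ℓ) →
    schurAfter p μ ≈ _⋆_ (support μ) (transfer (support μ)) (λ c → schurAfter c (Vec.map pred μ)) p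
  schurAfter-peel μ p = ↭-trans
    (sumOver-allFillings μ _)
    (sumOver-cong (columns (support μ)) λ c → ↭-trans
      (sumOver-cong (allFillings K (Vec.map pred μ)) (term c))
      (↭-sym (sumOver-⊗ˡ (transfer (support μ) p c) (allFillings K (Vec.map pred μ)) _)))
    where
    open PermutationReasoning
    term : ∀ c T → when (fits? p (glue μ c T)) (weight (entries (glue μ c T))) ≈
                   transfer (support μ) p c ⊗ when (fits? c T) (weight (entries T))
    term c T = begin
      when (fits? p (glue μ c T)) (weight (entries (glue μ c T)))
        ↭⟨ when-cong (fits? p (glue μ c T)) (↭-trans (weight-↭ (entries-glue μ c T)) (≈-reflexive (weight-++ es (entries T)))) ⟩
      when (fits? p (glue μ c T)) (weight es ⊗ weight (entries T))
        ≡⟨ when-⇔ (fits-glue⇔ μ p c T) (fits? p (glue μ c T)) (step? (support μ) p c ×-dec fits? c T) _ ⟩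
      when (step? (support μ) p c ×-dec fits? c T) (weight es ⊗ weight (entries T))
        ≡⟨ when-⊗ (step? (support μ) p c) (fits? c T) (weight es) (weight (entries T)) ⟩
      transfer (support μ) p c ⊗ when (fits? c T) (weight (entries T)) ∎
      where es = columnEntries (support μ) c

  support-pred : {μ : Vec ℕ ℓ} → All (λ m → m ≡ 0 ⊎ suc (suc n) ≤ m) μ →
                 support (Vec.map pred μ) ≡ support μ
  support-pred []                                 = refl
  support-pred (inj₁ refl ∷ long)                 = cong (false ∷_) (support-pred long)
  support-pred (inj₂ (s≤s (s≤s _)) ∷ long)        = cong (true ∷_) (support-pred long)

  long-pred : {μ : Vec ℕ ℓ} → All (λ m → m ≡ 0 ⊎ suc n ≤ m) μ →
              All (λ m → m ≡ 0 ⊎ n ≤ m) (Vec.map pred μ)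
  long-pred []                       = []
  long-pred (inj₁ refl ∷ long)       = inj₁ refl ∷ long-pred long
  long-pred (inj₂ (s≤s n≤) ∷ long)   = inj₂ n≤ ∷ long-pred long

  -- If every nonempty row has at least n + 1 cells, the first n + 1 columns meet the same rows and
  -- one matrix acts n + 1 times. `b` is a separate variable because the support of the peeled shape
  -- equals it only through `support-pred`.
  schurAfter-power : ∀ n (μ : Vec ℕ ℓ) {b} → support μ ≡ b → All (λ m → m ≡ 0 ⊎ suc n ≤ m) μ →
    ∀ p → schurAfter p μ ≈
          _⋆_ b (power b (transfer b) n) (λ c → schurAfter c (Vec.map (_∸ suc n) μ)) p
  schurAfter-power zero    μ refl long p = schurAfter-peel μ p
  schurAfter-power (suc n) μ refl long p = ↭-trans
    (schurAfter-peel μ p)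
    (↭-trans
      (⋆-congʳ supp (transfer supp) rest p)
      (↭-sym (⋆-assoc supp (transfer supp) (power supp (transfer supp) n) _ p)))
    where
    supp = support μ
    μ-eq : Vec.map (_∸ suc n) (Vec.map pred μ) ≡ Vec.map (_∸ suc (suc n)) μ
    μ-eq = trans (sym (Vec.map-∘ (_∸ suc n) pred μ)) (Vec.map-cong (λ m → ℕ.∸-+-assoc m 1 (suc n)) μ)
    rest : ∀ c → schurAfter c (Vec.map pred μ) ≈
           _⋆_ supp (power supp (transfer supp) n) (λ d → schurAfter d (Vec.map (_∸ suc (suc n)) μ)) c
    rest c = subst
      (λ ν → schurAfter c (Vec.map pred μ) ≈ _⋆_ supp (power supp (transfer supp) n) (λ d → schurAfter d ν) c)
      μ-eq (schurAfter-power n (Vec.map pred μ) (support-pred long) (long-pred long) c)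

-- Blocks of columns of equal height

rank : Vec ℕ ℓ → ℕ
rank []          = 0
rank (zero  ∷ μ) = rank μ
rank (suc m ∷ μ) = suc (rank μ)

rank≤ℓ : (μ : Vec ℕ ℓ) → rank μ ≤ ℓ
rank≤ℓ []          = z≤n
rank≤ℓ (zero  ∷ μ) = ℕ.m≤n⇒m≤1+n (rank≤ℓ μ)
rank≤ℓ (suc m ∷ μ) = s≤s (rank≤ℓ μ)

rank-∸-≤ : ∀ n (μ : Vec ℕ ℓ) → rank (Vec.map (_∸ suc n) μ) ≤ rank μ
rank-∸-≤ n []          = z≤n
rank-∸-≤ n (zero  ∷ μ) = rank-∸-≤ n μ
rank-∸-≤ n (suc m ∷ μ) with m ∸ n
... | zero  = ℕ.m≤n⇒m≤1+n (rank-∸-≤ n μ)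
... | suc _ = s≤s (rank-∸-≤ n μ)

-- A part equal to the number of removed columns becomes 0 and no zero part revives, so every block
-- uses up at least one row.
rank-∸-< : (μ : Vec ℕ ℓ) → Any (suc n ≡_) μ → rank (Vec.map (_∸ suc n) μ) < rank μ
rank-∸-< {n = n} (suc m ∷ μ) (here refl) rewrite ℕ.n∸n≡0 m = s≤s (rank-∸-≤ n μ)
rank-∸-< {n = n} (zero  ∷ μ) (there any) = rank-∸-< μ any
rank-∸-< {n = n} (suc m ∷ μ) (there any) with m ∸ n
... | zero  = ℕ.m≤n⇒m≤1+n (rank-∸-< μ any)
... | suc _ = s≤s (rank-∸-< μ any)

rank≡0⇒zero : (μ : Vec ℕ ℓ) → rank μ ≡ 0 → All (_≡ 0) μ
rank≡0⇒zero []         _  = []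
rank≡0⇒zero (zero ∷ μ) r0 = refl ∷ rank≡0⇒zero μ r0

-- The least nonzero part is the width of the leftmost block of columns meeting the same rows; that
-- it is attained makes `rank` drop when the block is removed.
shortestPart : (μ : Vec ℕ ℓ) →
  rank μ ≡ 0 ⊎ ∃ λ n → All (λ m → m ≡ 0 ⊎ suc n ≤ m) μ × Any (suc n ≡_) μ
shortestPart []         = inj₁ refl
shortestPart (zero ∷ μ) with shortestPart μ
... | inj₁ r0              = inj₁ r0
... | inj₂ (n , all , any) = inj₂ (n , inj₁ refl ∷ all , there any)
shortestPart (suc m ∷ μ) with shortestPart μ
... | inj₁ r0              = inj₂ (m , inj₂ ℕ.≤-refl ∷ All.map inj₁ (rank≡0⇒zero μ r0) , here refl)
... | inj₂ (n , all , any) with m ≤? n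
...   | yes m≤n = inj₂ (m , inj₂ ℕ.≤-refl ∷ All.map weaken all , here refl)
  where
  weaken : ∀ {x} → x ≡ 0 ⊎ suc n ≤ x → x ≡ 0 ⊎ suc m ≤ x
  weaken (inj₁ x≡0) = inj₁ x≡0
  weaken (inj₂ n<x) = inj₂ (ℕ.≤-trans (s≤s m≤n) n<x)
...   | no m≰n  = inj₂ (n , inj₂ (ℕ.m≤n⇒m≤1+n (ℕ.≰⇒> m≰n)) ∷ all , there any)

allFillings-zero : (μ : Vec ℕ ℓ) → rank μ ≡ 0 →
  ∃ λ (T : Filling k μ) → allFillings k μ ≡ [ T ] × entries T ≡ []
allFillings-zero []         _  = [] , refl , refl
allFillings-zero {k = k} (zero ∷ μ) r0 with allFillings-zero {k = k} μ r0
... | T , eq , eqₑ rewrite eq = [] ∷ T , refl , eqₑ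

Known-when : (a? : Dec A) {p : Poly k} → Known C p → Known C (when a? p)
Known-when (yes _) Kp = Kp
Known-when (no  _) _  = vanishes ↭-refl

-- Without cells the only filling has weight 1, so the value is 1 or 0 according to `fits?`, and
-- both are known.
Known-schurAfter-zero : (p : Vec (Fin k) ℓ) (μ : Vec ℕ ℓ) → rank μ ≡ 0 → Known C (schurAfter p μ)
Known-schurAfter-zero {k = k} p μ rank≡0 with allFillings-zero {k = k} μ rank≡0
... | T , fillings≡ , entries≡ = Known-resp (≈-reflexive (sym schurAfter≡))
  (Known-when (fits? p T) (Known-resp (≈-reflexive (cong weight (sym entries≡))) Known-one))
  where
  schurAfter≡ : schurAfter p μ ≡ when (fits? p T) (weight (entries T))
  schurAfter≡ = trans (cong (λ Ts → sumOver Ts (λ T → when (fits? p T) (weight (entries T)))) fillings≡)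
                      (List.++-identityʳ _)

-- Completeness and size of the enumerations

allRows-complete : (r : Vec (Fin k) m) → r ∈ allRows k m
allRows-complete []      = here refl
allRows-complete (a ∷ r) = ∈-cartesianProductWith⁺ _∷_ (∈-allFin a) (allRows-complete r)

allFillings-complete : {μ : Vec ℕ ℓ} (T : Filling k μ) → T ∈ allFillings k μ
allFillings-complete []      = here refl
allFillings-complete (r ∷ T) = ∈-cartesianProductWith⁺ _∷_ (allRows-complete r) (allFillings-complete T)

length-allFin : ∀ k → length (allFin k) ≡ k
length-allFin k = List.length-tabulate {n = k} id

length-allRows : ∀ k m → length (allRows k m) ≡ k ^ m
length-allRows k zero    = refl
length-allRows k (suc m) = trans (length-cartesianProductWith _∷_ (allFin k) (allRows k m))
  (cong₂ _*_ (length-allFin k) (length-allRows k m))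

length-columns : (b : Vec Bool ℓ) → length (columns {k = k} b) ≤ suc k ^ ℓ
length-columns []      = ℕ.≤-refl
length-columns {k = k} (a ∷ b) = ℕ.≤-trans
  (ℕ.≤-reflexive (length-cartesianProductWith _∷_ (choices a) (columns b)))
  (ℕ.*-mono-≤ (length-choices a) (length-columns b))
  where
  length-choices : ∀ a → length (choices {k} a) ≤ suc k
  length-choices true  = ℕ.≤-reflexive (length-allFin (suc k))
  length-choices false = s≤s z≤n

-- The summands pay for N² transfer entries of ℓ gates each, for t rounds of two
-- matrix products, and for one matrix-vector product.
phaseCost : ℕ → ℕ → ℕ → ℕ
phaseCost ℓ t N = N * N * ℓ + (t * (N * N * (N * 2) + N * N * (N * 2)) + N * (N * 2))

module _ {k ℓ : ℕ} {L t : ℕ} (L< : L < 2 ^ suc t) where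

  private
    N : ℕ
    N = suc k ^ ℓ

  -- The block has n + 1 ≤ L < 2^(t + 1) columns, so t rounds of squaring suffice. The transfer
  -- matrix is built anew, as the support changes between blocks.
  reach-phase : (μ : Vec ℕ ℓ) → suc n ≤ L → All (λ m → m ≡ 0 ⊎ suc n ≤ m) μ →
    (∀ p → Known C (schurAfter p (Vec.map (_∸ suc n) μ))) →
    Reach C (phaseCost ℓ t N) (λ D → ∀ (p : Vec (Fin (suc k)) ℓ) → Known D (schurAfter p μ))
  reach-phase {n = n} μ n<L long K =
    Reach-map (λ _ K p → Known-resp (↭-sym (schurAfter-power n μ refl long p)) (K p))
      (Reach-≤ cost≤
        (bind (reach-matrix (transfer b) reach-transfer) λ C≼D K₁ →
          bind (reach-power K₁ t n (ℕ.≤-<-trans n<L L<)) λ D≼E K₂ →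
            reach-⋆ K₂ (λ p → D≼E (C≼D (K p)))))
    where
    b = support μ
    open MatrixCircuits (allRows (suc k) ℓ) (columns {k = k} b) allRows-complete

    reach-transfer : ∀ {D} → _ ≼ D → ∀ p c → Reach D ℓ (λ E → Known E (transfer b p c))
    reach-transfer _ p c = Reach-map (λ _ → Known-when (step? b p c))
      (Reach-≤ (length-columnEntries b c) (reach-∏var (columnEntries b c)))

    N≡ : length (allRows (suc k) ℓ) ≡ N
    N≡ = length-allRows (suc k) ℓ

    product≤ : productCost ≤ N * N * (N * 2)
    product≤ = ℕ.*-mono-≤ (ℕ.≤-reflexive (cong₂ _*_ N≡ N≡)) (ℕ.*-monoˡ-≤ 2 (length-columns b))

    cost≤ : length (allRows (suc k) ℓ) * length (allRows (suc k) ℓ) * ℓ +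
            (t * (productCost + productCost) +
             length (allRows (suc k) ℓ) * (length (columns {k = k} b) * 2)) ≤ phaseCost ℓ t N
    cost≤ = ℕ.+-mono-≤ (ℕ.≤-reflexive (cong₂ (λ x y → x * y * ℓ) N≡ N≡))
      (ℕ.+-mono-≤ (ℕ.*-monoʳ-≤ t (ℕ.+-mono-≤ product≤ product≤))
        (ℕ.*-mono-≤ (ℕ.≤-reflexive N≡) (ℕ.*-monoˡ-≤ 2 (length-columns b))))

  -- The vector for the shape right of the first block is computed before that block acts on it.
  -- Parts only shrink, so L remains a bound, and `rank` falls with every block.
  reach-schurAfter : ∀ s (μ : Vec ℕ ℓ) → rank μ ≤ s → All (_≤ L) μ →
    Reach C (s * phaseCost ℓ t N) (λ D → ∀ (p : Vec (Fin (suc k)) ℓ) → Known D (schurAfter p μ))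
  reach-schurAfter zero    μ rank≤ _   = stay (λ p → Known-schurAfter-zero p μ (ℕ.n≤0⇒n≡0 rank≤))
  reach-schurAfter (suc s) μ rank≤ ≤L with shortestPart μ
  ... | inj₁ rank≡0 = stay (λ p → Known-schurAfter-zero p μ rank≡0)
  ... | inj₂ (n , long , any) = Reach-≤ (ℕ.≤-reflexive (ℕ.+-comm (s * phaseCost ℓ t N) _))
    (bind (reach-schurAfter s (Vec.map (_∸ suc n) μ)
            (ℕ.≤-pred (ℕ.≤-trans (rank-∸-< μ any) rank≤))
            (All-map⁺ (All.map (ℕ.≤-trans (ℕ.m∸n≤m _ (suc n))) ≤L)))
      (λ _ → reach-phase μ (part≤ any ≤L) long))
    where
    part≤ : ∀ {ℓ} {μ : Vec ℕ ℓ} → Any (suc n ≡_) μ → All (_≤ L) μ → suc n ≤ L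
    part≤ (here refl) (m≤ ∷ _) = m≤
    part≤ (there any) (_ ∷ ms) = part≤ any ms

-- Nonvanishing of Schur polynomials

rowConstant : (μ : Vec ℕ ℓ) → (Fin ℓ → Fin k) → Filling k μ
rowConstant []      f = []
rowConstant (m ∷ μ) f = Vec.replicate m (f zero) ∷ rowConstant μ (f ∘ suc)

entry-rowConstant : (μ : Vec ℕ ℓ) (f : Fin ℓ → Fin k) → ∀ i j → entry (rowConstant μ f) i j ≡ f i
entry-rowConstant (m ∷ μ) f zero    j = Vec.lookup-replicate j (f zero)
entry-rowConstant (m ∷ μ) f (suc i) j = entry-rowConstant μ (f ∘ suc) i j

-- Each row is filled with its own index, available since ℓ ≤ k: constant along rows, increasing by
-- one down columns.
rowConstant-semistandard : (μ : Vec ℕ ℓ) (ℓ≤k : ℓ ≤ k) →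
  IsSemistandard (rowConstant μ (λ i → Fin.inject≤ i ℓ≤k))
rowConstant-semistandard μ ℓ≤k =
  (λ i j j′ _ → Fin.≤-reflexive (trans (entry-rowConstant μ f i j) (sym (entry-rowConstant μ f i j′)))) ,
  (λ i i′ i′≡ j j′ _ → strict i i′ i′≡ (entry-rowConstant μ f i j) (entry-rowConstant μ f i′ j′))
  where
  f = λ i → Fin.inject≤ i ℓ≤k
  strict : ∀ i i′ → toℕ i′ ≡ suc (toℕ i) → ∀ {a b} → a ≡ f i → b ≡ f i′ → a Fin.< b
  strict i i′ i′≡ refl refl = ℕ.≤-reflexive (trans (cong suc (Fin.toℕ-inject≤ i ℓ≤k))
    (trans (sym i′≡) (sym (Fin.toℕ-inject≤ i′ ℓ≤k))))

weight-singleton : (is : List (Fin k)) → ∃ λ x → weight is ≡ [ x ]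
weight-singleton []       = _ , refl
weight-singleton (i ∷ is) with weight is | weight-singleton is
... | _ | x , refl = _ , refl

-- Coefficients are natural numbers, so nothing cancels.
sumOver≢[] : {xs : List A} {x : A} (f : A → Poly k) → x ∈ xs → ¬ f x ≡ [] → ¬ sumOver xs f ≡ []
sumOver≢[] {xs = x ∷ xs} f (here refl) fx≢[] sum≡[] = fx≢[] (List.++-conicalˡ (f x) _ sum≡[])
sumOver≢[] {xs = x ∷ xs} f (there x∈)  fx≢[] sum≡[] =
  sumOver≢[] f x∈ fx≢[] (List.++-conicalʳ (f x) _ sum≡[])

schur≢[] : (μ : Vec ℕ ℓ) → ℓ ≤ k → ¬ schur k μ ≡ []
schur≢[] μ ℓ≤k = sumOver≢[] (weight ∘ entries)
  (∈-filter⁺ isSemistandard? (allFillings-complete T) (rowConstant-semistandard μ ℓ≤k))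
  (λ w≡[] → contradiction (trans (sym (proj₂ (weight-singleton (entries T)))) w≡[]) λ ())
  where T = rowConstant μ (λ i → Fin.inject≤ i ℓ≤k)

-- `zero` is the least entry, so a column of zeros on the left restricts nothing.
schur≈schurAfter : (μ : Vec ℕ ℓ) → schurAfter (Vec.replicate ℓ zero) μ ≈ schur (suc k) μ
schur≈schurAfter {ℓ = ℓ} {k = k} μ = ↭-sym (↭-trans
  (≈-reflexive (sumOver-filter isSemistandard? (weight ∘ entries) (allFillings (suc k) μ)))
  (sumOver-cong (allFillings (suc k) μ) λ T →
    ≈-reflexive (when-⇔ (mk⇔ (_, below T) proj₁) (isSemistandard? T) (fits? (Vec.replicate ℓ zero) T) _)))
  where
  below : (T : Filling (suc k) μ) → Below (Vec.replicate ℓ zero) T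
  below T i j _ = subst (Fin._≤ entry T i j) (sym (Vec.lookup-replicate i zero)) z≤n

partition≤first : {μ : Vec ℕ ℓ} → IsPartition μ → All (_≤ firstPart μ) μ
partition≤first {μ = []}    _      = []
partition≤first {μ = _ ∷ _} sorted = Linked⇒All (flip ℕ.≤-trans) ℕ.≤-refl sorted

-- The numerical bound

n<2^[1+⌊log₂n⌋] : ∀ n → n < 2 ^ suc ⌊log₂ n ⌋
n<2^[1+⌊log₂n⌋] n = ℕ.≰⇒> λ 2^≤n → ℕ.<-irrefl refl
  (subst (_≤ ⌊log₂ n ⌋) (⌊log₂[2^n]⌋≡n (suc ⌊log₂ n ⌋)) (⌊log₂⌋-mono-≤ 2^≤n))

-- The threshold is 10 because 9³ = 729 exceeds 2^9 = 512, while 10³ = 1000 is 24 below 2^10.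
[10+m]³≤2^[10+m] : ∀ m → (10 + m) ^ 3 ≤ 2 ^ (10 + m)
[10+m]³≤2^[10+m] zero    = ℕ.m≤m+n 1000 24
[10+m]³≤2^[10+m] (suc m) = begin
  (11 + m) ^ 3                                        ≤⟨ ℕ.m≤m+n _ _ ⟩
  -- The added polynomial is the difference 2(10 + m)³ - (11 + m)³, with positive coefficients.
  (11 + m) ^ 3 + (669 + 237 * m + 27 * m ^ 2 + m ^ 3) ≡⟨ expand m ⟩
  2 * (10 + m) ^ 3                                    ≤⟨ ℕ.*-monoʳ-≤ 2 ([10+m]³≤2^[10+m] m) ⟩
  2 * 2 ^ (10 + m)                                    ∎
  where
  open ℕ.≤-Reasoning
  expand : ∀ m → (11 + m) ^ 3 + (669 + 237 * m + 27 * m ^ 2 + m ^ 3) ≡ 2 * (10 + m) ^ 3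
  expand = solve 1 (λ m → (con 11 :+ m) :^ 3 :+ (con 669 :+ con 237 :* m :+ con 27 :* m :^ 2 :+ m :^ 3)
                       := con 2 :* (con 10 :+ m) :^ 3) refl
    where open +-*-Solver

-- For k ≥ 10 the number k^ℓ of columns satisfies (k^ℓ)³ ≤ 2^(kℓ) because
-- k³ ≤ 2^k; the finitely many smaller pairs ℓ ≤ k are covered by the constant.
-- `smallCases` is abstract so that its numeral is never unfolded.

abstract

  smallCases : ℕ
  smallCases = (9 ^ 3) ^ 9

  smallCases-nonZero : NonZero smallCases
  smallCases-nonZero = ℕ.m^n≢0 (9 ^ 3) 9

  smallCases-bound : ∀ {k ℓ} → k ≤ 9 → ℓ ≤ 9 → (k ^ 3) ^ ℓ ≤ smallCases
  smallCases-bound {ℓ = ℓ} k≤9 ℓ≤9 =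
    ℕ.≤-trans (ℕ.^-monoˡ-≤ ℓ (ℕ.^-monoˡ-≤ 3 k≤9)) (ℕ.^-monoʳ-≤ (9 ^ 3) ℓ≤9)

k^3ℓ-bound : ∀ {k ℓ} → ℓ ≤ k → (k ^ 3) ^ ℓ ≤ smallCases * 2 ^ (k * ℓ)
k^3ℓ-bound {k} {ℓ} ℓ≤k with k ≤? 9
... | yes k≤9 = ℕ.≤-trans (smallCases-bound k≤9 (ℕ.≤-trans ℓ≤k k≤9))
                          (ℕ.m≤m*n smallCases (2 ^ (k * ℓ)) {{ℕ.m^n≢0 2 (k * ℓ)}})
... | no k≰9 = begin
  (k ^ 3) ^ ℓ                ≤⟨ ℕ.^-monoˡ-≤ ℓ k³≤2^k ⟩
  (2 ^ k) ^ ℓ                ≡⟨ ℕ.^-*-assoc 2 k ℓ ⟩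
  2 ^ (k * ℓ)                ≤⟨ ℕ.m≤n*m (2 ^ (k * ℓ)) smallCases {{smallCases-nonZero}} ⟩
  smallCases * 2 ^ (k * ℓ)   ∎
  where
  open ℕ.≤-Reasoning
  k³≤2^k : k ^ 3 ≤ 2 ^ k
  k³≤2^k = subst (λ x → x ^ 3 ≤ 2 ^ x) (ℕ.m+[n∸m]≡n (ℕ.≰⇒> k≰9)) ([10+m]³≤2^[10+m] (k ∸ 10))

-- Each summand is padded to a multiple of ℓ t N³; the multiples are 1 for the entries, 4 for the
-- powers and 2 for the matrix-vector product.
phaseCost≤ : ∀ ℓ t N .{{_ : NonZero ℓ}} .{{_ : NonZero t}} .{{_ : NonZero N}} →
             phaseCost ℓ t N ≤ 7 * (ℓ * t * N ^ 3)
phaseCost≤ ℓ t N = begin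
  phaseCost ℓ t N
    ≤⟨ ℕ.+-mono-≤ (ℕ.m≤m*n (N * N * ℓ) (t * N) {{ℕ.m*n≢0 t N}})
         (ℕ.+-mono-≤ (ℕ.m≤m*n (t * (N * N * (N * 2) + N * N * (N * 2))) ℓ)
                     (ℕ.m≤m*n (N * (N * 2)) (ℓ * t * N) {{ℕ.m*n≢0 (ℓ * t) N {{ℕ.m*n≢0 ℓ t}}}})) ⟩
  N * N * ℓ * (t * N) + (t * (N * N * (N * 2) + N * N * (N * 2)) * ℓ + N * (N * 2) * (ℓ * t * N))
    ≡⟨ solve 3 (λ ℓ t N → N :* N :* ℓ :* (t :* N) :+
         (t :* (N :* N :* (N :* con 2) :+ N :* N :* (N :* con 2)) :* ℓ :+ N :* (N :* con 2) :* (ℓ :* t :* N))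
         := con 7 :* (ℓ :* t :* N :^ 3)) refl ℓ t N ⟩
  7 * (ℓ * t * N ^ 3) ∎
  where
  open ℕ.≤-Reasoning
  open +-*-Solver

-- One ℓ counts blocks and the other comes from `phaseCost`; together they fit into k^5, while N³
-- goes into 2^(kℓ) by `k^3ℓ-bound`.
totalCost≤ : ∀ {k ℓ t} d → ℓ ≤ k → .{{_ : NonZero ℓ}} .{{_ : NonZero t}} .{{_ : NonZero k}} →
             ℓ * phaseCost ℓ t (k ^ ℓ) ≤ 7 * smallCases * t * k ^ 5 * 2 ^ (k * ℓ) * ℓ ^ d
totalCost≤ {k} {ℓ} {t} d ℓ≤k = begin
  ℓ * phaseCost ℓ t N                      ≤⟨ ℕ.*-monoʳ-≤ ℓ (phaseCost≤ ℓ t N {{it}} {{it}} {{ℕ.m^n≢0 k ℓ}}) ⟩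
  ℓ * (7 * (ℓ * t * N ^ 3))                ≡⟨ reorder₁ ℓ t (N ^ 3) ⟩
  7 * t * ℓ ^ 2 * N ^ 3                    ≤⟨ ℕ.*-mono-≤ (ℕ.*-monoʳ-≤ (7 * t) ℓ²≤k⁵) N³≤ ⟩
  7 * t * k ^ 5 * (smallCases * 2 ^ (k * ℓ))   ≡⟨ reorder₂ (smallCases) t (k ^ 5) (2 ^ (k * ℓ)) ⟩
  bound                                    ≤⟨ ℕ.m≤m*n bound (ℓ ^ d) {{ℕ.m^n≢0 ℓ d}} ⟩
  bound * ℓ ^ d                            ∎
  where
  open ℕ.≤-Reasoning
  open +-*-Solver
  N = k ^ ℓ
  bound = 7 * smallCases * t * k ^ 5 * 2 ^ (k * ℓ)

  reorder₁ : ∀ ℓ t x → ℓ * (7 * (ℓ * t * x)) ≡ 7 * t * ℓ ^ 2 * x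
  reorder₁ = solve 3 (λ ℓ t x → ℓ :* (con 7 :* (ℓ :* t :* x)) := con 7 :* t :* ℓ :^ 2 :* x) refl

  reorder₂ : ∀ c t x y → 7 * t * x * (c * y) ≡ 7 * c * t * x * y
  reorder₂ = solve 4 (λ c t x y → con 7 :* t :* x :* (c :* y) := con 7 :* c :* t :* x :* y) refl

  ℓ²≤k⁵ : ℓ ^ 2 ≤ k ^ 5
  ℓ²≤k⁵ = ℕ.≤-trans (ℕ.^-monoˡ-≤ 2 ℓ≤k) (ℕ.^-monoʳ-≤ k {2} {5} (s≤s (s≤s z≤n)))

  N³≤ : N ^ 3 ≤ smallCases * 2 ^ (k * ℓ)
  N³≤ = begin
    (k ^ ℓ) ^ 3  ≡⟨ ℕ.^-*-assoc k ℓ 3 ⟩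
    k ^ (ℓ * 3)  ≡⟨ cong (k ^_) (ℕ.*-comm ℓ 3) ⟩
    k ^ (3 * ℓ)  ≡⟨ ℕ.^-*-assoc k 3 ℓ ⟨
    (k ^ 3) ^ ℓ  ≤⟨ k^3ℓ-bound ℓ≤k ⟩
    smallCases * 2 ^ (k * ℓ) ∎

-- A vanishing polynomial has no source to serve as output, so this is the point where zero is
-- excluded.
Known⇒computable : ∀ {f : Poly k} {b} → ¬ f ≡ [] → size C ≤ b → Known C f → SemiringComplexity≤ f b
Known⇒computable f≢[] size≤ (vanishes f≈[]) = contradiction (↭-empty-inv f≈[]) f≢[]
Known⇒computable {C = n , c} f≢[] size≤ (computed s s≈f) = n , size≤ , c , s , s≈f

theorem1p1 : ∃ λ (C : ℕ) → C > 0 × (∀ (k ℓ : ℕ) → k ≥ ℓ → ℓ ≥ 1 →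
    (μ : Vec ℕ ℓ) → IsPartition μ → firstPart μ ≥ 2 →
    SemiringComplexity≤ (schur k μ)
    (C * ⌊log₂ firstPart μ ⌋ * k ^ 5 * 2 ^ (k * ℓ) * ℓ ^ maxProduct k μ))
theorem1p1 = 7 * smallCases , >-nonZero⁻¹ (7 * smallCases) {{ℕ.m*n≢0 7 smallCases {{it}} {{smallCases-nonZero}}}} , λ where
  zero    (suc _) () _
  (suc k) ℓ@(suc _) ℓ≤k _ μ sorted first≥2 →
    -- Since the logarithm of 2 is 1, a first part of at least 2 gives t ≥ 1, which lets the factor
    -- t absorb the costs free of it.
    let instance log≢0 = >-nonZero (⌊log₂⌋-mono-≤ first≥2)
        reach D D≤ _ K = reach-schurAfter {k = k} {t = ⌊log₂ firstPart μ ⌋} (n<2^[1+⌊log₂n⌋] (firstPart μ)) {C = 0 , ∅} ℓ μ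
                           (rank≤ℓ μ) (partition≤first sorted)
    in Known⇒computable (schur≢[] μ ℓ≤k)
         (ℕ.≤-trans (ℕ.≤-trans D≤ (ℕ.≤-reflexive (ℕ.+-identityʳ _)))
                    (totalCost≤ {t = ⌊log₂ firstPart μ ⌋} (maxProduct (suc k) μ) ℓ≤k))
         (Known-resp (schur≈schurAfter μ) (K (Vec.replicate ℓ zero)))
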